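{- There is no (deterministic or randomized) list decodable adaptive protocol that robustly simulates the $n$-bit Exchange Protocol for an error rate of $1/2$ with failure probability $o(1)$ and a list size of $2^{n-1}$, even when allowing computationally unbounded protocols that use an arbitrarily large number of rounds and an unbounded alphabet.
   Context: $n$-bit Exchange Protocol: Alice receives $i_A\in\{0,1\}^n$, Bob receives $i_B\in\{0,1\}^n$, and each party wants to know the other party's string. Communication model. Alice and Bob interact for a fixed number $N$ of rounds over a communication alphabet (of any size). In each round each party decides, as a function of its private input, the history of communication it has seen, and (for randomized protocols) its own independent private randomness, whether to listen or to transmit, and in the latter case which symbol to transmit. There is no shared randomness. A protocol is adaptive if the decision to listen or transmit may depend on the history, input and randomness, so that both parties may transmit, or both may listen, in the same round. Rules of a round: if exactly one party transmits, the listening party receives the transmitted symbol, unless the adversary replaces it by an arbitrary symbol of the alphabet, which counts as one error; if both parties transmit, no symbol is delivered; if both parties listen, each receives a symbol chosen by the adversary, and this is not counted as an error. The adversary has error rate $\rho$ if it makes at most $\rho N$ errors in total; it knows the protocol but not the private randomness. A list decodable protocol with list size $L$ robustly simulates the $n$-bit Exchange Protocol for error rate $\rho$ with failure probability $p$ if, for every pair of inputs and every adversary of error rate $\rho$, with probability at least $1-p$ each of the two parties outputs a list of at most $L$ strings in $\{0,1\}^n$ that contains the other party's input. "No protocol with failure probability $o(1)$" means: there is no sequence of such protocols (with arbitrary $n\ge 1$, numbers of rounds and alphabets) whose failure probabilities tend to $0$. -}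

module Defs where

open import Algebra.Apartness.Bundles using (HeytingField)
open import Data.Bool using (Bool; if_then_else_)
open import Data.Bool.Properties using () renaming (_≟_ to _≟ᵇ_)
open import Data.Integer using (+_)
open import Data.List using (List; []; _∷_; length)
open import Data.List.Membership.Propositional using (_∈_)
import Data.List.Membership.DecPropositional as DecMembership
open import Data.Maybe using (Maybe; just; nothing)
open import Data.Nat using (ℕ; zero; suc; _≤?_)
import Data.Nat as ℕ
open import Data.Product using (Σ-syntax; _×_; _,_)
open import Data.Rational using (ℚ; _/_)
import Data.Rational as ℚ
open import Data.Unit using (⊤)
open import Data.Vec using (Vec)
open import Data.Vec.Properties using (≡-dec)
open import Level using (Level; _⊔_) renaming (suc to lsuc)
open import Relation.Binary.Core using (Rel)
open import Relation.Binary.Structures using (IsTotalOrder)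
open import Relation.Nullary using (Dec; does)
open import Relation.Nullary.Decidable using (_×-dec_)

-- Probabilities take values in an arbitrary ordered field, which stands in
-- for the real numbers.
record OrderedField c ℓ₁ ℓ₂ ℓ₃ : Set (lsuc (c ⊔ ℓ₁ ⊔ ℓ₂ ⊔ ℓ₃)) where
  infix 4 _≤_ _<_
  field
    heytingField : HeytingField c ℓ₁ ℓ₂

  open HeytingField heytingField public

  field
    _≤_          : Rel Carrier ℓ₃
    isTotalOrder : IsTotalOrder _≈_ _≤_
    +-monoˡ-≤    : ∀ z {x y} → x ≤ y → (x + z) ≤ (y + z)
    *-nonneg     : ∀ {x y} → 0# ≤ x → 0# ≤ y → 0# ≤ (x * y)

  _<_ : Rel Carrier (ℓ₂ ⊔ ℓ₃)
  x < y = (x ≤ y) × (x # y)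

module _ {c ℓ₁ ℓ₂ ℓ₃ : Level} (𝔽 : OrderedField c ℓ₁ ℓ₂ ℓ₃) where
  open OrderedField 𝔽

  TendsToZero : (ℕ → Carrier) → Set (c ⊔ ℓ₂ ⊔ ℓ₃)
  TendsToZero p =
    ∀ ε → 0# < ε → Σ[ K ∈ ℕ ] (∀ k → K ℕ.≤ k → ((- ε) < p k) × (p k < ε))

  Bounded : {Ω : Set} → (Ω → Carrier) → Set (c ⊔ ℓ₃)
  Bounded {Ω} f = Σ[ b ∈ Carrier ] (∀ ω → ((- b) ≤ f ω) × (f ω ≤ b))

  -- A probability distribution on Ω, presented by the expectation of bounded
  -- random variables; the value of 𝔼 on unbounded functions is irrelevant.
  -- Only finite additivity is required, and every function is measurable.
  -- This covers finite and discrete distributions directly, and any countably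
  -- additive probability space through an extension of its integral to all
  -- bounded functions (Hahn–Banach).
  record Distribution (Ω : Set) : Set (c ⊔ ℓ₁ ⊔ ℓ₃) where
    field
      𝔼       : (Ω → Carrier) → Carrier
      𝔼-one   : 𝔼 (λ _ → 1#) ≈ 1#
      𝔼-mono  : ∀ f g → Bounded f → Bounded g →
                (∀ ω → f ω ≤ g ω) → 𝔼 f ≤ 𝔼 g
      𝔼-add   : ∀ f g → Bounded f → Bounded g →
                𝔼 (λ ω → f ω + g ω) ≈ (𝔼 f + 𝔼 g)
      𝔼-scale : ∀ a f → Bounded f → 𝔼 (λ ω → a * f ω) ≈ (a * 𝔼 f)

  open Distribution public

  indicator : {a : Level} {P : Set a} → Dec P → Carrier
  indicator P? = if does P? then 1# else 0#

  -- Probability of an event under the independent product of two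
  -- distributions, as an iterated integral.
  ℙ : {Ω₁ Ω₂ : Set} → Distribution Ω₁ → Distribution Ω₂ →
      {a : Level} {P : Ω₁ → Ω₂ → Set a} → (∀ α β → Dec (P α β)) → Carrier
  ℙ μ ν P? = 𝔼 μ (λ α → 𝔼 ν (λ β → indicator (P? α β)))

Bits : ℕ → Set
Bits n = Vec Bool n

data Action (S : Set) : Set where
  transmit : S → Action S
  listen   : Action S

data Event (S : Set) : Set where
  sent  : S → Event S
  heard : S → Event S

-- The adversary's options, given Alice's and Bob's actions: a lone
-- transmission may be left alone or replaced; two listeners are each given a
-- symbol.
Interference : {S : Set} → Action S → Action S → Set
Interference     (transmit _) (transmit _) = ⊤
Interference {S} (transmit _) listen       = Maybe S
Interference {S} listen       (transmit _) = Maybe S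
Interference {S} listen       listen       = S × S

errorCount : {S : Set} (a b : Action S) → Interference a b → ℕ
errorCount (transmit _) (transmit _) _        = 0
errorCount (transmit _) listen       nothing  = 0
errorCount (transmit _) listen       (just _) = 1
errorCount listen       (transmit _) nothing  = 0
errorCount listen       (transmit _) (just _) = 1
errorCount listen       listen       _        = 0

aliceEvent : {S : Set} (a b : Action S) → Interference a b → Event S
aliceEvent (transmit s) _            _        = sent s
aliceEvent listen       (transmit s) nothing  = heard s
aliceEvent listen       (transmit _) (just t) = heard t
aliceEvent listen       listen       (s , _)  = heard s

bobEvent : {S : Set} (a b : Action S) → Interference a b → Event S
bobEvent _            (transmit s) _        = sent s
bobEvent (transmit s) listen       nothing  = heard s
bobEvent (transmit _) listen       (just t) = heard t
bobEvent listen       listen       (_ , t)  = heard t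

-- The adversary sees the actions of the current round and of all earlier
-- rounds (most recent first); together with its own strategy these determine
-- everything delivered so far.
Adversary : Set → Set
Adversary S = List (Action S × Action S) → (a b : Action S) → Interference a b

module _ {c ℓ₁ ℓ₂ ℓ₃ : Level} (𝔽 : OrderedField c ℓ₁ ℓ₂ ℓ₃) where
  open OrderedField 𝔽 using (Carrier; 1#; _-_) renaming (_≤_ to _≤ᶠ_)

  -- A list of events is the party's history, most recent event first.  All
  -- private randomness is drawn at the start; a deterministic party ignores
  -- it.
  record Party (n : ℕ) (S : Set) : Set (lsuc Level.zero ⊔ c ⊔ ℓ₁ ⊔ ℓ₃) where
    field
      Ω      : Set
      law    : Distribution 𝔽 Ω
      act    : Bits n → Ω → List (Event S) → Action S
      output : Bits n → Ω → List (Event S) → List (Bits n)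

  -- The alphabet is inhabited: otherwise the adversary would have nothing to
  -- deliver to two listening parties.
  record Protocol (n : ℕ) : Set (lsuc Level.zero ⊔ c ⊔ ℓ₁ ⊔ ℓ₃) where
    field
      rounds   : ℕ
      Alphabet : Set
      symbol   : Alphabet
      alice    : Party n Alphabet
      bob      : Party n Alphabet

  record State (S : Set) : Set where
    field
      aliceHistory : List (Event S)
      bobHistory   : List (Event S)
      actions      : List (Action S × Action S)
      errors       : ℕ

  module _ {n : ℕ} (Π : Protocol n) where
    open Protocol Π
    private
      module A = Party alice
      module B = Party bob

    run : Adversary Alphabet → (x y : Bits n) → A.Ω → B.Ω → ℕ → State Alphabet
    run adv x y α β zero = record
      { aliceHistory = [] ; bobHistory = [] ; actions = [] ; errors = 0 }
    run adv x y α β (suc t) = record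
      { aliceHistory = aliceEvent a b i ∷ aliceHistory
      ; bobHistory   = bobEvent a b i ∷ bobHistory
      ; actions      = (a , b) ∷ actions
      ; errors       = errors ℕ.+ errorCount a b i
      }
      where
      open State (run adv x y α β t)
      a : Action Alphabet
      a = A.act x α aliceHistory
      b : Action Alphabet
      b = B.act y β bobHistory
      i : Interference a b
      i = adv actions a b

    execute : Adversary Alphabet → (x y : Bits n) → A.Ω → B.Ω → State Alphabet
    execute adv x y α β = run adv x y α β rounds

    -- The bound holds in every execution, whatever the inputs and randomness.
    HasErrorRate : ℚ → Adversary Alphabet → Set
    HasErrorRate ρ adv = ∀ x y α β →
      (+ State.errors (execute adv x y α β) / 1) ℚ.≤ (ρ ℚ.* (+ rounds / 1))

    aliceOutput : Adversary Alphabet → (x y : Bits n) → A.Ω → B.Ω → List (Bits n)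
    aliceOutput adv x y α β =
      A.output x α (State.aliceHistory (execute adv x y α β))

    bobOutput : Adversary Alphabet → (x y : Bits n) → A.Ω → B.Ω → List (Bits n)
    bobOutput adv x y α β =
      B.output y β (State.bobHistory (execute adv x y α β))

    ListDecodes : ℕ → Bits n → List (Bits n) → Set
    ListDecodes L z zs = (length zs ℕ.≤ L) × (z ∈ zs)

    listDecodes? : ∀ L z zs → Dec (ListDecodes L z zs)
    listDecodes? L z zs = (length zs ≤? L) ×-dec (z ∈? zs)
      where open DecMembership (≡-dec _≟ᵇ_) using (_∈?_)

    Success : ℕ → Adversary Alphabet → (x y : Bits n) → A.Ω → B.Ω → Set
    Success L adv x y α β =
      ListDecodes L y (aliceOutput adv x y α β) ×
      ListDecodes L x (bobOutput adv x y α β)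

    success? : ∀ L adv x y α β → Dec (Success L adv x y α β)
    success? L adv x y α β =
      listDecodes? L y (aliceOutput adv x y α β) ×-dec
      listDecodes? L x (bobOutput adv x y α β)

    RobustlySimulates : ℕ → ℚ → Carrier → Set ℓ₃
    RobustlySimulates L ρ p = ∀ x y adv → HasErrorRate ρ adv →
      (1# - p) ≤ᶠ ℙ 𝔽 A.law B.law (success? L adv x y)

{-# OPTIONS --safe #-}
module Submission where

-- Play the protocol along a chain: A₀ hears only a fixed symbol, B hears A₀,
-- and A₂ hears B.  The pair (A₀ , B) is realised by isolating A₀, at the cost
-- of the rounds in which A₀ listens while B transmits; the pair (A₂ , B) by
-- impersonating A₀ towards B, at the cost of the rounds in which A₂ transmits
-- while B listens.  These sets of rounds are disjoint, so one of the two
-- attacks stays within half of the rounds.  The list of A₀ does not depend on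
-- the input of B, nor that of B on the input of A₂; as a list covers at most
-- half of the inputs, averaging over both inputs makes the two failure
-- probabilities add up to at least 1/4.  The field need not decide whether 2
-- is apart from 0, so ½ is only available up to double negation, which
-- suffices for a negative conclusion.

open import Defs
open import Algebra.Apartness.Bundles using (HeytingCommutativeRing)
open import Algebra.Bundles using (CommutativeRing)
import Algebra.Properties.CommutativeSemigroup as CommutativeSemigroupProperties
import Algebra.Properties.Ring as RingProperties
import Algebra.Properties.Semiring.Exp as Exponentiation
import Algebra.Properties.Semiring.Mult as Multiples
import Algebra.Solver.Ring.NaturalCoefficients.Default as SemiringSolver
open import Data.Bool using (true; false)
open import Data.Bool.Properties using () renaming (_≟_ to _≟ᵇ_)
open import Data.Integer using (+_; +≤+)
import Data.Integer as ℤ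
import Data.Integer.Properties as ℤ
open import Data.List using (List; []; _∷_; length)
import Data.List.Membership.DecPropositional as DecMembership
open import Data.Maybe using (just; nothing)
open import Data.Nat using (ℕ; zero; suc; _≤?_; z≤n; s≤s)
import Data.Nat as ℕ
import Data.Nat.Properties as ℕ
open import Data.Product using (Σ-syntax; _×_; _,_; proj₁; proj₂)
open import Data.Rational using (½; _/_)
import Data.Rational as ℚ
import Data.Rational.Properties as ℚ
import Data.Rational.Unnormalised as ℚᵘ
import Data.Rational.Unnormalised.Properties as ℚᵘ
open import Data.Sum using (_⊎_; inj₁; inj₂)
open import Data.Unit using (tt)
open import Data.Vec using ([]; _∷_; replicate)
open import Data.Vec.Properties using (≡-dec; ∷-injectiveʳ)
open import Function using (_∘_)
open import Relation.Binary.Bundles using (Poset)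
open import Relation.Binary.PropositionalEquality as ≡ using (_≡_)
import Relation.Binary.Reasoning.PartialOrder as PartialOrderReasoning
open import Relation.Binary.Structures using (IsTotalOrder)
open import Relation.Nullary using (¬_; Dec; yes; no; contradiction)

open CommutativeSemigroupProperties ℕ.+-commutativeSemigroup using () renaming (interchange to +-interchange)

-- The rational error budget in terms of natural numbers.

-- In unnormalised rationals this is an inequality between integer cross products. All other error
-- counting stays in ℕ, with "at most half" expressed by doubling.
n+n≤m⇒n/1≤½*m/1 : ∀ {n m} → n ℕ.+ n ℕ.≤ m → (+ n / 1) ℚ.≤ (½ ℚ.* (+ m / 1))
n+n≤m⇒n/1≤½*m/1 {n} {m} n+n≤m = ℚ.toℚᵘ-cancel-≤ (begin
  ℚ.toℚᵘ (+ n / 1)                 ≃⟨ ℚ.toℚᵘ-fromℚᵘ (ℚᵘ.mkℚᵘ (+ n) 0) ⟩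
  + n ℚᵘ./ 1                       ≤⟨ ℚᵘ.*≤* (≡.subst₂ ℤ._≤_ (lhs n) (rhs m) (+≤+ n+n≤m)) ⟩
  ℚᵘ.½ ℚᵘ.* (+ m ℚᵘ./ 1)           ≃⟨ ℚᵘ.*-congˡ {ℚᵘ.½} (ℚ.toℚᵘ-fromℚᵘ (ℚᵘ.mkℚᵘ (+ m) 0)) ⟨
  ℚ.toℚᵘ ½ ℚᵘ.* ℚ.toℚᵘ (+ m / 1)   ≃⟨ ℚ.toℚᵘ-homo-* ½ (+ m / 1) ⟨
  ℚ.toℚᵘ (½ ℚ.* (+ m / 1))         ∎)
  where
  open ℚᵘ.≤-Reasoning
  lhs : ∀ n → + (n ℕ.+ n) ≡ + n ℤ.* + 2
  lhs n = ≡.trans (≡.cong +_ (≡.trans (≡.cong (n ℕ.+_) (≡.sym (ℕ.+-identityʳ n))) (ℕ.*-comm 2 n))) (ℤ.pos-* n 2)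
  rhs : ∀ m → + m ≡ (+ 1 ℤ.* + m) ℤ.* + 1
  rhs m = ≡.sym (≡.trans (ℤ.*-identityʳ _) (ℤ.*-identityˡ _))

-- Budgeted adversaries, one-party views and the two attacks.

module _ {S : Set} where

  harmless : S → (a b : Action S) → Interference a b
  harmless s (transmit _) (transmit _) = tt
  harmless s (transmit _) listen       = nothing
  harmless s listen       (transmit _) = nothing
  harmless s listen       listen       = s , s

  errorCount-harmless : ∀ s (a b : Action S) → errorCount a b (harmless s a b) ≡ 0
  errorCount-harmless s (transmit _) (transmit _) = ≡.refl
  errorCount-harmless s (transmit _) listen       = ≡.refl
  errorCount-harmless s listen       (transmit _) = ≡.refl
  errorCount-harmless s listen       listen       = ≡.refl

  -- An adversary and the past actions determine all past interference, so the errors can be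
  -- recomputed from the action history. This lets an adversary monitor its own spending.
  totalErrors : Adversary S → List (Action S × Action S) → ℕ
  totalErrors adv []            = 0
  totalErrors adv ((a , b) ∷ h) = totalErrors adv h ℕ.+ errorCount a b (adv h a b)

  -- The budget is charged with the errors adv would have made without the cap,
  -- an overestimate that never decreases: once exceeded, adv is off for good.
  capped : ℕ → S → Adversary S → Adversary S
  capped N s adv h a b
    with totalErrors adv ((a , b) ∷ h) ℕ.+ totalErrors adv ((a , b) ∷ h) ≤? N
  ... | yes _ = adv h a b
  ... | no  _ = harmless s a b

  capped-within : ∀ N s adv h a b →
    totalErrors adv ((a , b) ∷ h) ℕ.+ totalErrors adv ((a , b) ∷ h) ℕ.≤ N →
    capped N s adv h a b ≡ adv h a b
  capped-within N s adv h a b le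
    with totalErrors adv ((a , b) ∷ h) ℕ.+ totalErrors adv ((a , b) ∷ h) ≤? N
  ... | yes _ = ≡.refl
  ... | no ¬le = contradiction le ¬le

  totalErrors-capped-≤ : ∀ N s adv h → totalErrors (capped N s adv) h ℕ.≤ totalErrors adv h
  totalErrors-capped-≤ N s adv [] = z≤n
  totalErrors-capped-≤ N s adv ((a , b) ∷ h)
    with totalErrors adv ((a , b) ∷ h) ℕ.+ totalErrors adv ((a , b) ∷ h) ≤? N
  ... | yes _ = ℕ.+-monoˡ-≤ _ (totalErrors-capped-≤ N s adv h)
  ... | no  _ rewrite errorCount-harmless s a b =
    ℕ.+-mono-≤ (totalErrors-capped-≤ N s adv h) z≤n

  -- In a round where the cap permits `adv`, the uncapped total is within budget and bounds what was
  -- really spent. In any other round nothing is spent.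
  totalErrors-capped-bound : ∀ N s adv h →
    totalErrors (capped N s adv) h ℕ.+ totalErrors (capped N s adv) h ℕ.≤ N
  totalErrors-capped-bound N s adv [] = z≤n
  totalErrors-capped-bound N s adv ((a , b) ∷ h)
    with totalErrors adv ((a , b) ∷ h) ℕ.+ totalErrors adv ((a , b) ∷ h) ≤? N
  ... | yes le = ℕ.≤-trans (ℕ.+-mono-≤ step step) le
    where step = ℕ.+-monoˡ-≤ (errorCount a b (adv h a b)) (totalErrors-capped-≤ N s adv h)
  ... | no  _ rewrite errorCount-harmless s a b
                    | ℕ.+-identityʳ (totalErrors (capped N s adv) h) =
    totalErrors-capped-bound N s adv h

  symbolOr : S → Action S → S
  symbolOr s (transmit t) = t
  symbolOr s listen       = s

  perceive : S → Action S → Action S → Event S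
  perceive s (transmit t) _ = sent t
  perceive s listen       m = heard (symbolOr s m)

  -- The history of one party fed by a fixed stream `m` of incoming actions, silence being heard as
  -- `s`. Neither an adversary nor a second party occurs, so the same view can describe two
  -- different executions.
  view : S → (List (Event S) → Action S) → (ℕ → Action S) → ℕ → List (Event S)
  view s act m zero    = []
  view s act m (suc t) = perceive s (act (view s act m t)) (m t) ∷ view s act m t

  emit : S → (List (Event S) → Action S) → (ℕ → Action S) → ℕ → Action S
  emit s act m t = act (view s act m t)

  silence : ℕ → Action S
  silence _ = listen

  isolateAlice : S → Adversary S
  isolateAlice s h (transmit _) (transmit _) = tt
  isolateAlice s h (transmit _) listen       = nothing
  isolateAlice s h listen       (transmit _) = just s
  -- This is free, and what Bob receives is exactly how `perceive` renders a silent Alice.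
  isolateAlice s h listen       listen       = s , s

  -- Bob is to hear the script `m`, whose current entry is selected by the number `length h` of
  -- completed rounds. Overriding a lone transmission of Alice costs an error even if the script
  -- agrees with it; when both listen, the script is delivered for free.
  impersonateAlice : S → (ℕ → Action S) → Adversary S
  impersonateAlice s m h (transmit _) (transmit _) = tt
  impersonateAlice s m h (transmit _) listen       = just (symbolOr s (m (length h)))
  impersonateAlice s m h listen       (transmit _) = nothing
  impersonateAlice s m h listen       listen       = s , symbolOr s (m (length h))

  aliceEvent-isolateAlice : ∀ s h (a b : Action S) →
    aliceEvent a b (isolateAlice s h a b) ≡ perceive s a listen
  aliceEvent-isolateAlice s h (transmit _) _            = ≡.refl
  aliceEvent-isolateAlice s h listen       (transmit _) = ≡.refl
  aliceEvent-isolateAlice s h listen       listen       = ≡.refl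

  bobEvent-isolateAlice : ∀ s h (a b : Action S) →
    bobEvent a b (isolateAlice s h a b) ≡ perceive s b a
  bobEvent-isolateAlice s h (transmit _) (transmit _) = ≡.refl
  bobEvent-isolateAlice s h (transmit _) listen       = ≡.refl
  bobEvent-isolateAlice s h listen       (transmit _) = ≡.refl
  bobEvent-isolateAlice s h listen       listen       = ≡.refl

  bobEvent-impersonateAlice : ∀ s m h (a b : Action S) →
    bobEvent a b (impersonateAlice s m h a b) ≡ perceive s b (m (length h))
  bobEvent-impersonateAlice s m h (transmit _) (transmit _) = ≡.refl
  bobEvent-impersonateAlice s m h listen       (transmit _) = ≡.refl
  bobEvent-impersonateAlice s m h (transmit _) listen       = ≡.refl
  bobEvent-impersonateAlice s m h listen       listen       = ≡.refl

  -- The two adversaries pay in disjoint sets of rounds: one only when Bob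
  -- transmits, the other only when Bob listens.
  errorCount-disjoint : ∀ s m h h′ (a a′ b : Action S) →
    errorCount a b (isolateAlice s h a b) ℕ.+
    errorCount a′ b (impersonateAlice s m h′ a′ b) ℕ.≤ 1
  errorCount-disjoint s m h h′ (transmit _) (transmit _) (transmit _) = z≤n
  errorCount-disjoint s m h h′ (transmit _) listen       (transmit _) = z≤n
  errorCount-disjoint s m h h′ listen       (transmit _) (transmit _) = s≤s z≤n
  errorCount-disjoint s m h h′ listen       listen       (transmit _) = s≤s z≤n
  errorCount-disjoint s m h h′ (transmit _) (transmit _) listen       = s≤s z≤n
  errorCount-disjoint s m h h′ (transmit _) listen       listen       = z≤n
  errorCount-disjoint s m h h′ listen       (transmit _) listen       = s≤s z≤n
  errorCount-disjoint s m h h′ listen       listen       listen       = z≤n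

-- The smaller summand is at most half of the sum.
m+n≤o⇒m+m≤o⊎n+n≤o : ∀ m n {o} → m ℕ.+ n ℕ.≤ o → m ℕ.+ m ℕ.≤ o ⊎ n ℕ.+ n ℕ.≤ o
m+n≤o⇒m+m≤o⊎n+n≤o m n m+n≤o with ℕ.≤-total m n
... | inj₁ m≤n = inj₁ (ℕ.≤-trans (ℕ.+-monoʳ-≤ m m≤n) m+n≤o)
... | inj₂ n≤m = inj₂ (ℕ.≤-trans (ℕ.+-monoˡ-≤ n n≤m) m+n≤o)

-- Executions under the two attacks.

module _ {c ℓ₁ ℓ₂ ℓ₃} (𝔽 : OrderedField c ℓ₁ ℓ₂ ℓ₃) {n : ℕ} (Π : Protocol 𝔽 n) where
  open Protocol Π
  open State
  private
    module A = Party alice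
    module B = Party bob

  module _ (x y : Bits n) (α : A.Ω) (β : B.Ω) where

    private
      go : Adversary Alphabet → ℕ → State 𝔽 Alphabet
      go adv t = run 𝔽 Π adv x y α β t

      -- The successor clause of `run` with the interference as an argument, so that the preceding
      -- state and the interference can be rewritten separately.
      record-round : State 𝔽 Alphabet → (a b : Action Alphabet) → Interference a b →
                     State 𝔽 Alphabet
      record-round st a b i = record
        { aliceHistory = aliceEvent a b i ∷ aliceHistory st
        ; bobHistory   = bobEvent a b i ∷ bobHistory st
        ; actions      = (a , b) ∷ actions st
        ; errors       = errors st ℕ.+ errorCount a b i
        }

      advance : Adversary Alphabet → State 𝔽 Alphabet → State 𝔽 Alphabet
      advance adv st = record-round st a b (adv (actions st) a b)
        where
        a = A.act x α (aliceHistory st)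
        b = B.act y β (bobHistory st)

    errors-run : ∀ adv t → errors (go adv t) ≡ totalErrors adv (actions (go adv t))
    errors-run adv zero    = ≡.refl
    errors-run adv (suc t) = ≡.cong (ℕ._+ latest) (errors-run adv t)
      where
      latest : ℕ
      latest = errorCount (A.act x α (aliceHistory (go adv t))) (B.act y β (bobHistory (go adv t)))
                          (adv (actions (go adv t)) _ _)

    length-actions-run : ∀ adv t → length (actions (go adv t)) ≡ t
    length-actions-run adv zero    = ≡.refl
    length-actions-run adv (suc t) = ≡.cong suc (length-actions-run adv t)

    -- The error count never decreases, so a budget respected at the end was respected in every
    -- earlier round, and the cap never took effect.
    run-capped : ∀ N adv t → errors (go adv t) ℕ.+ errors (go adv t) ℕ.≤ N →
      go (capped N symbol adv) t ≡ go adv t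
    run-capped N adv zero    _  = ≡.refl
    run-capped N adv (suc t) le = ≡.trans
      (≡.cong (advance (capped N symbol adv))
            (run-capped N adv t (ℕ.≤-trans (ℕ.+-mono-≤ growing growing) le)))
      (≡.cong (record-round (go adv t) _ _)
            (capped-within N symbol adv (actions (go adv t)) _ _
              (≡.subst (λ e → e ℕ.+ e ℕ.≤ N) (errors-run adv (suc t)) le)))
      where
      growing : errors (go adv t) ℕ.≤ errors (go adv (suc t))
      growing = ℕ.m≤m+n (errors (go adv t)) _

  -- The cap works on every action history, hence for all inputs and all randomness at once, as
  -- `HasErrorRate` demands. The bare attacks may overspend in some executions.
  capped-hasErrorRate : ∀ adv → HasErrorRate 𝔽 Π ½ (capped rounds symbol adv)
  capped-hasErrorRate adv x y α β = n+n≤m⇒n/1≤½*m/1 {errors final}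
    (≡.subst (λ e → e ℕ.+ e ℕ.≤ rounds)
      (≡.sym (errors-run x y α β (capped rounds symbol adv) rounds))
      (totalErrors-capped-bound rounds symbol adv (actions final)))
    where
    final = execute 𝔽 Π (capped rounds symbol adv) x y α β

  -- In the chain, `isolatedView` and `isolatedSpeech` belong to A₀, and `deceivedView` to B
  -- listening to A₀.
  isolatedView : Bits n → A.Ω → ℕ → List (Event Alphabet)
  isolatedView x α = view symbol (A.act x α) silence

  isolatedSpeech : Bits n → A.Ω → ℕ → Action Alphabet
  isolatedSpeech x α = emit symbol (A.act x α) silence

  deceivedView : Bits n → A.Ω → Bits n → B.Ω → ℕ → List (Event Alphabet)
  deceivedView x α y β = view symbol (B.act y β) (isolatedSpeech x α)

  module _ (x : Bits n) (α : A.Ω) (y : Bits n) (β : B.Ω) where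

    private
      isolated : ℕ → State 𝔽 Alphabet
      isolated = run 𝔽 Π (isolateAlice symbol) x y α β

      deceived : Bits n → A.Ω → ℕ → State 𝔽 Alphabet
      deceived x′ α′ = run 𝔽 Π (impersonateAlice symbol (isolatedSpeech x α)) x′ y α′ β

    aliceHistory-isolated : ∀ t → aliceHistory (isolated t) ≡ isolatedView x α t
    aliceHistory-isolated zero    = ≡.refl
    aliceHistory-isolated (suc t) = ≡.cong₂ _∷_
      (≡.trans (aliceEvent-isolateAlice symbol (actions (isolated t)) _ (B.act y β (bobHistory (isolated t))))
             (≡.cong (λ h → perceive symbol (A.act x α h) listen) (aliceHistory-isolated t)))
      (aliceHistory-isolated t)

    bobHistory-isolated : ∀ t → bobHistory (isolated t) ≡ deceivedView x α y β t
    bobHistory-isolated zero    = ≡.refl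
    bobHistory-isolated (suc t) = ≡.cong₂ _∷_
      (≡.trans (bobEvent-isolateAlice symbol (actions (isolated t)) _ _)
             (≡.cong₂ (λ g h → perceive symbol (B.act y β g) (A.act x α h))
                    (bobHistory-isolated t) (aliceHistory-isolated t)))
      (bobHistory-isolated t)

    -- Whenever Bob listens he receives the script, whatever the real Alice does; so neither her
    -- input nor her randomness affects him.
    bobHistory-deceived : ∀ x′ α′ t →
      bobHistory (deceived x′ α′ t) ≡ deceivedView x α y β t
    bobHistory-deceived x′ α′ zero    = ≡.refl
    bobHistory-deceived x′ α′ (suc t) = ≡.cong₂ _∷_
      (≡.trans (bobEvent-impersonateAlice symbol _ (actions (deceived x′ α′ t)) (A.act x′ α′ (aliceHistory (deceived x′ α′ t))) _)
             (≡.cong₂ (λ g k → perceive symbol (B.act y β g) (isolatedSpeech x α k))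
                    (bobHistory-deceived x′ α′ t)
                    (length-actions-run x′ y α′ β _ t)))
      (bobHistory-deceived x′ α′ t)

    -- Bob has the same history in both executions and hence acts identically, so in each round at
    -- most one of the attacks pays.
    errors-isolated+deceived : ∀ x′ α′ t →
      errors (isolated t) ℕ.+ errors (deceived x′ α′ t) ℕ.≤ t
    errors-isolated+deceived x′ α′ zero    = z≤n
    errors-isolated+deceived x′ α′ (suc t)
      rewrite bobHistory-isolated t | bobHistory-deceived x′ α′ t = begin
        (e ℕ.+ d) ℕ.+ (e′ ℕ.+ d′)  ≡⟨ +-interchange e d e′ d′ ⟩
        (e ℕ.+ e′) ℕ.+ (d ℕ.+ d′)
          ≤⟨ ℕ.+-mono-≤ (errors-isolated+deceived x′ α′ t)
               (errorCount-disjoint symbol _ (actions (isolated t)) (actions (deceived x′ α′ t)) a a′ b) ⟩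
        t ℕ.+ 1                    ≡⟨ ℕ.+-comm t 1 ⟩
        suc t                      ∎
      where
      open ℕ.≤-Reasoning
      a = A.act x α (aliceHistory (isolated t))
      a′ = A.act x′ α′ (aliceHistory (deceived x′ α′ t))
      b = B.act y β (deceivedView x α y β t)
      e = errors (isolated t)
      e′ = errors (deceived x′ α′ t)
      d = errorCount a b (isolateAlice symbol (actions (isolated t)) a b)
      d′ = errorCount a′ b (impersonateAlice symbol (isolatedSpeech x α) (actions (deceived x′ α′ t)) a′ b)

    -- For fixed inputs and randomness, the cheaper attack is unaffected by its cap, so success
    -- against it is success of the corresponding idealised list. The first list does not depend on
    -- `y`, the second not on `x′`.
    isolation-or-deception : ∀ L x′ α′ →
      (Success 𝔽 Π L (capped rounds symbol (isolateAlice symbol)) x y α β →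
       ListDecodes 𝔽 Π L y (A.output x α (isolatedView x α rounds)))
      ⊎
      (Success 𝔽 Π L
         (capped rounds symbol (impersonateAlice symbol (isolatedSpeech x α))) x′ y α′ β →
       ListDecodes 𝔽 Π L x′ (B.output y β (deceivedView x α y β rounds)))
    isolation-or-deception L x′ α′
      with m+n≤o⇒m+m≤o⊎n+n≤o (errors (isolated rounds)) (errors (deceived x′ α′ rounds))
             (errors-isolated+deceived x′ α′ rounds)
    ... | inj₁ le = inj₁ λ success → ≡.subst (ListDecodes 𝔽 Π L y)
      (≡.cong (A.output x α)
        (≡.trans (≡.cong aliceHistory (run-capped x y α β rounds (isolateAlice symbol) rounds le))
               (aliceHistory-isolated rounds)))
      (proj₁ success)
    ... | inj₂ le = inj₂ λ success → ≡.subst (ListDecodes 𝔽 Π L x′)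
      (≡.cong (B.output y β)
        (≡.trans (≡.cong bobHistory (run-capped x′ y α′ β rounds _ rounds le))
               (bobHistory-deceived x′ α′ rounds)))
      (proj₂ success)

-- Arithmetic in an ordered field.

module _ {c ℓ₁ ℓ₂ ℓ₃} (𝔽 : OrderedField c ℓ₁ ℓ₂ ℓ₃) where
  open OrderedField 𝔽
  open IsTotalOrder isTotalOrder using (total; antisym; isPartialOrder)
    renaming (refl to ≤-refl; reflexive to ≤-reflexive; trans to ≤-trans)

  private
    commutativeRing : CommutativeRing c ℓ₁
    commutativeRing = HeytingCommutativeRing.commutativeRing heytingCommutativeRing

    poset : Poset c ℓ₁ ℓ₃
    poset = record { isPartialOrder = isPartialOrder }

  open PartialOrderReasoning poset
  open RingProperties (CommutativeRing.ring commutativeRing)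
    using (-‿distribˡ-*; -‿distribʳ-*; -‿+-comm; -‿involutive; -0#≈0#)
  open SemiringSolver (CommutativeRing.commutativeSemiring commutativeRing)
    using (solve; _:=_; _:+_; _:*_)
  open Multiples (CommutativeRing.semiring commutativeRing)
    using (×-homo-+; ×-comm-*) renaming (_×_ to _·_)
  open Exponentiation (CommutativeRing.semiring commutativeRing) using (_^_)

  +-mono-≤ : ∀ {w x y z} → w ≤ x → y ≤ z → w + y ≤ x + z
  +-mono-≤ {w} {x} {y} {z} w≤x y≤z = begin
    w + y  ≤⟨ +-monoˡ-≤ y w≤x ⟩
    x + y  ≈⟨ +-comm x y ⟩
    y + x  ≤⟨ +-monoˡ-≤ x y≤z ⟩
    z + x  ≈⟨ +-comm z x ⟩
    x + z  ∎

  neg-anti-≤ : ∀ {x y} → x ≤ y → - y ≤ - x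
  neg-anti-≤ {x} {y} x≤y = begin
    - y              ≈⟨ +-identityˡ (- y) ⟨
    0# + - y         ≈⟨ +-congʳ (-‿inverseʳ x) ⟨
    (x + - x) + - y  ≤⟨ +-monoˡ-≤ (- y) (+-monoˡ-≤ (- x) x≤y) ⟩
    (y + - x) + - y  ≈⟨ solve 3 (λ a b c → (a :+ b) :+ c := b :+ (a :+ c)) refl y (- x) (- y) ⟩
    - x + (y + - y)  ≈⟨ +-congˡ (-‿inverseʳ y) ⟩
    - x + 0#         ≈⟨ +-identityʳ (- x) ⟩
    - x              ∎

  x≤0⇒0≤-x : ∀ {x} → x ≤ 0# → 0# ≤ - x
  x≤0⇒0≤-x {x} x≤0 = begin
    0#    ≈⟨ -0#≈0# ⟨
    - 0#  ≤⟨ neg-anti-≤ x≤0 ⟩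
    - x   ∎

  0≤x⇒-x≤0 : ∀ {x} → 0# ≤ x → - x ≤ 0#
  0≤x⇒-x≤0 {x} 0≤x = begin
    - x   ≤⟨ neg-anti-≤ 0≤x ⟩
    - 0#  ≈⟨ -0#≈0# ⟩
    0#    ∎

  +-cancelˡ-≤ : ∀ z {x y} → z + x ≤ z + y → x ≤ y
  +-cancelˡ-≤ z {x} {y} z+x≤z+y = begin
    x              ≈⟨ cancel x ⟨
    - z + (z + x)  ≤⟨ +-mono-≤ ≤-refl z+x≤z+y ⟩
    - z + (z + y)  ≈⟨ cancel y ⟩
    y              ∎
    where
    cancel : ∀ x → - z + (z + x) ≈ x
    cancel x = trans (sym (+-assoc (- z) z x)) (trans (+-congʳ (-‿inverseˡ z)) (+-identityˡ x))

  0≤1 : 0# ≤ 1#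
  0≤1 with total 0# 1#
  ... | inj₁ 0≤1 = 0≤1
  ... | inj₂ 1≤0 = begin
    0#               ≤⟨ *-nonneg (x≤0⇒0≤-x 1≤0) (x≤0⇒0≤-x 1≤0) ⟩
    - 1# * - 1#      ≈⟨ -‿distribˡ-* 1# (- 1#) ⟨
    - (1# * - 1#)    ≈⟨ -‿cong (*-identityˡ (- 1#)) ⟩
    - (- 1#)         ≈⟨ -‿involutive 1# ⟩
    1#               ∎

  *-monoʳ-≤ : ∀ {a x y} → 0# ≤ a → x ≤ y → a * x ≤ a * y
  *-monoʳ-≤ {a} {x} {y} 0≤a x≤y = begin
    a * x                          ≈⟨ +-identityˡ _ ⟨
    0# + a * x                     ≤⟨ +-monoˡ-≤ (a * x) (*-nonneg 0≤a 0≤y-x) ⟩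
    a * (y + - x) + a * x          ≈⟨ distribˡ a (y + - x) x ⟨
    a * ((y + - x) + x)            ≈⟨ *-congˡ (+-assoc y (- x) x) ⟩
    a * (y + (- x + x))            ≈⟨ *-congˡ (+-congˡ (-‿inverseˡ x)) ⟩
    a * (y + 0#)                   ≈⟨ *-congˡ (+-identityʳ y) ⟩
    a * y                          ∎
    where
    0≤y-x : 0# ≤ y + - x
    0≤y-x = begin
      0#       ≈⟨ -‿inverseʳ x ⟨
      x + - x  ≤⟨ +-monoˡ-≤ (- x) x≤y ⟩
      y + - x  ∎

  -- The difference `1# - 0#` is invertible, which makes `1#` apart from `0#`.
  1≉0 : ¬ 1# ≈ 0#
  1≉0 1≈0 = #-irrefl 1≈0 (invertible⇒# (1# , invˡ , invʳ))
    where
    1-0≈1 : 1# + - 0# ≈ 1#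
    1-0≈1 = trans (+-congˡ -0#≈0#) (+-identityʳ 1#)
    invˡ : 1# * (1# + - 0#) ≈ 1#
    invˡ = trans (*-identityˡ _) 1-0≈1
    invʳ : (1# + - 0#) * 1# ≈ 1#
    invʳ = trans (*-identityʳ _) 1-0≈1

  ≉⇒¬¬# : ∀ {x y} → ¬ x ≈ y → ¬ ¬ x # y
  ≉⇒¬¬# {x} {y} x≉y ¬x#y = x≉y (proj₁ (tight x y) ¬x#y)

  -- Since `1# + 1#` is at least `1#`, it differs from `0#`; by tightness its apartness from `0#`
  -- cannot be refuted, and apartness would yield an inverse.
  ¬¬half : ¬ (∀ h → ¬ h + h ≈ 1#)
  ¬¬half noHalf = ≉⇒¬¬# 1+1≉0 λ 1+1#0 → noHalf′ (#⇒invertible 1+1#0)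
    where
    1+1≉0 : ¬ 1# + 1# ≈ 0#
    1+1≉0 1+1≈0 = 1≉0 (antisym
      (begin
        1#       ≈⟨ +-identityˡ 1# ⟨
        0# + 1#  ≤⟨ +-monoˡ-≤ 1# 0≤1 ⟩
        1# + 1#  ≈⟨ 1+1≈0 ⟩
        0#       ∎)
      0≤1)
    noHalf′ : ¬ (Σ[ h ∈ Carrier ] (h * ((1# + 1#) + - 0#) ≈ 1# × ((1# + 1#) + - 0#) * h ≈ 1#))
    noHalf′ (h , inv , _) = noHalf h (begin-equality
      h + h                      ≈⟨ +-cong (*-identityʳ h) (*-identityʳ h) ⟨
      h * 1# + h * 1#            ≈⟨ distribˡ h 1# 1# ⟨
      h * (1# + 1#)              ≈⟨ *-congˡ (+-identityʳ _) ⟨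
      h * ((1# + 1#) + 0#)       ≈⟨ *-congˡ (+-congˡ -0#≈0#) ⟨
      h * ((1# + 1#) + - 0#)     ≈⟨ inv ⟩
      1#                         ∎)

  -- Indicators, bounded random variables and expectations.

  module _ {p} {P : Set p} where

    indicator-yes : P → (P? : Dec P) → indicator 𝔽 P? ≈ 1#
    indicator-yes _ (yes _) = refl
    indicator-yes x (no ¬x) = contradiction x ¬x

    indicator-no : ¬ P → (P? : Dec P) → indicator 𝔽 P? ≈ 0#
    indicator-no ¬x (yes x) = contradiction x ¬x
    indicator-no _  (no _)  = refl

    0≤indicator : (P? : Dec P) → 0# ≤ indicator 𝔽 P?
    0≤indicator (yes _) = 0≤1
    0≤indicator (no _)  = ≤-refl

    indicator≤1 : (P? : Dec P) → indicator 𝔽 P? ≤ 1#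
    indicator≤1 (yes _) = ≤-refl
    indicator≤1 (no _)  = 0≤1

  indicator-mono : ∀ {p q} {P : Set p} {Q : Set q} → (P → Q) →
    (P? : Dec P) (Q? : Dec Q) → indicator 𝔽 P? ≤ indicator 𝔽 Q?
  indicator-mono P⇒Q (yes x) Q? = ≤-reflexive (sym (indicator-yes (P⇒Q x) Q?))
  indicator-mono P⇒Q (no _)  Q? = 0≤indicator Q?

  module _ {Ω : Set} where

    bounded-const : ∀ a → Bounded 𝔽 {Ω} (λ _ → a)
    bounded-const a with total 0# a
    ... | inj₁ 0≤a = a , λ _ → ≤-trans (0≤x⇒-x≤0 0≤a) 0≤a , ≤-refl
    ... | inj₂ a≤0 = - a , λ _ → ≤-reflexive (-‿involutive a) , ≤-trans a≤0 (x≤0⇒0≤-x a≤0)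

    bounded-+ : ∀ {f g} → Bounded 𝔽 {Ω} f → Bounded 𝔽 g → Bounded 𝔽 (λ ω → f ω + g ω)
    bounded-+ (b , b-f) (d , d-g) = b + d , λ ω →
      ≤-trans (≤-reflexive (sym (-‿+-comm b d)))
              (+-mono-≤ (proj₁ (b-f ω)) (proj₁ (d-g ω))) ,
      +-mono-≤ (proj₂ (b-f ω)) (proj₂ (d-g ω))

    bounded-* : ∀ a {f} → Bounded 𝔽 {Ω} f → Bounded 𝔽 (λ ω → a * f ω)
    bounded-* a {f} (b , b-f) with total 0# a
    ... | inj₁ 0≤a = a * b , λ ω →
      ≤-trans (≤-reflexive (-‿distribʳ-* a b)) (*-monoʳ-≤ 0≤a (proj₁ (b-f ω))) ,
      *-monoʳ-≤ 0≤a (proj₂ (b-f ω))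
    ... | inj₂ a≤0 = - a * b , λ ω → lower ω , upper ω
      where
      0≤-a = x≤0⇒0≤-x a≤0
      flip : ∀ x → - (- a * x) ≈ a * x
      flip x = trans (-‿cong (sym (-‿distribˡ-* a x))) (-‿involutive (a * x))
      lower : ∀ ω → - (- a * b) ≤ a * f ω
      lower ω = begin
        - (- a * b)    ≤⟨ neg-anti-≤ (*-monoʳ-≤ 0≤-a (proj₂ (b-f ω))) ⟩
        - (- a * f ω)  ≈⟨ flip (f ω) ⟩
        a * f ω        ∎
      upper : ∀ ω → a * f ω ≤ - a * b
      upper ω = begin
        a * f ω          ≈⟨ flip (f ω) ⟨
        - (- a * f ω)    ≈⟨ -‿distribʳ-* (- a) (f ω) ⟩
        - a * - (f ω)    ≤⟨ *-monoʳ-≤ 0≤-a (neg-anti-≤ (proj₁ (b-f ω))) ⟩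
        - a * - (- b)    ≈⟨ *-congˡ (-‿involutive b) ⟩
        - a * b          ∎

    bounded-indicator : ∀ {p} {P : Ω → Set p} (P? : ∀ ω → Dec (P ω)) →
      Bounded 𝔽 (λ ω → indicator 𝔽 (P? ω))
    bounded-indicator P? = 1# , λ ω →
      ≤-trans (0≤x⇒-x≤0 0≤1) (0≤indicator (P? ω)) , indicator≤1 (P? ω)

    module _ (μ : Distribution 𝔽 Ω) where

      -- Compatibility of `𝔼` with pointwise equality comes from monotonicity in both directions.
      𝔼-cong : ∀ f g → Bounded 𝔽 f → Bounded 𝔽 g → (∀ ω → f ω ≈ g ω) → 𝔼 μ f ≈ 𝔼 μ g
      𝔼-cong f g f-b g-b f≈g = antisym
        (𝔼-mono μ f g f-b g-b (≤-reflexive ∘ f≈g))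
        (𝔼-mono μ g f g-b f-b (≤-reflexive ∘ sym ∘ f≈g))

      𝔼-const : ∀ a → 𝔼 μ (λ _ → a) ≈ a
      𝔼-const a = begin-equality
        𝔼 μ (λ _ → a)       ≈⟨ 𝔼-cong _ _ (bounded-const a) (bounded-const (a * 1#)) (λ _ → sym (*-identityʳ a)) ⟩
        𝔼 μ (λ _ → a * 1#)  ≈⟨ 𝔼-scale μ a _ (bounded-const 1#) ⟩
        a * 𝔼 μ (λ _ → 1#)  ≈⟨ *-congˡ (𝔼-one μ) ⟩
        a * 1#                ≈⟨ *-identityʳ a ⟩
        a                     ∎

      ≤𝔼 : ∀ {a} f → Bounded 𝔽 f → (∀ ω → a ≤ f ω) → a ≤ 𝔼 μ f
      ≤𝔼 {a} f f-b a≤f = ≤-trans (≤-reflexive (sym (𝔼-const a)))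
        (𝔼-mono μ _ f (bounded-const a) f-b a≤f)

      𝔼≤ : ∀ {a} f → Bounded 𝔽 f → (∀ ω → f ω ≤ a) → 𝔼 μ f ≤ a
      𝔼≤ {a} f f-b f≤a = ≤-trans (𝔼-mono μ f _ f-b (bounded-const a) f≤a)
        (≤-reflexive (𝔼-const a))

  module _ {Ω₁ Ω₂ : Set} where

    bounded-slice : ∀ {f : Ω₁ × Ω₂ → Carrier} → Bounded 𝔽 f →
      ∀ α → Bounded 𝔽 (λ β → f (α , β))
    bounded-slice (b , b-f) α = b , λ β → b-f (α , β)

    bounded-𝔼 : (ν : Distribution 𝔽 Ω₂) → ∀ {f : Ω₁ × Ω₂ → Carrier} → Bounded 𝔽 f →
      Bounded 𝔽 (λ α → 𝔼 ν (λ β → f (α , β)))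
    bounded-𝔼 ν f-b@(b , b-f) = b , λ α →
      ≤𝔼 ν _ (bounded-slice f-b α) (λ β → proj₁ (b-f (α , β))) ,
      𝔼≤ ν _ (bounded-slice f-b α) (λ β → proj₂ (b-f (α , β)))

    infixr 2 _⊗_

    -- The iterated integral, inner variable second as in `ℙ`. Inner expectations inherit the bound
    -- of the integrand, so each law follows from that of `ν` and then that of `μ`.
    _⊗_ : Distribution 𝔽 Ω₁ → Distribution 𝔽 Ω₂ → Distribution 𝔽 (Ω₁ × Ω₂)
    μ ⊗ ν = record
      { 𝔼       = λ f → 𝔼 μ (λ α → 𝔼 ν (λ β → f (α , β)))
      ; 𝔼-one   = trans (𝔼-cong μ _ _ (bounded-const _) (bounded-const 1#) (λ _ → 𝔼-one ν))
                        (𝔼-one μ)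
      ; 𝔼-mono  = λ f g f-b g-b f≤g → 𝔼-mono μ _ _ (bounded-𝔼 ν f-b) (bounded-𝔼 ν g-b)
                    (λ α → 𝔼-mono ν _ _ (bounded-slice f-b α) (bounded-slice g-b α) (λ β → f≤g (α , β)))
      ; 𝔼-add   = λ f g f-b g-b → trans
                    (𝔼-cong μ _ _ (bounded-𝔼 ν (bounded-+ f-b g-b))
                      (bounded-+ (bounded-𝔼 ν f-b) (bounded-𝔼 ν g-b))
                      (λ α → 𝔼-add ν _ _ (bounded-slice f-b α) (bounded-slice g-b α)))
                    (𝔼-add μ _ _ (bounded-𝔼 ν f-b) (bounded-𝔼 ν g-b))
      ; 𝔼-scale = λ a f f-b → trans
                    (𝔼-cong μ _ _ (bounded-𝔼 ν (bounded-* a f-b)) (bounded-* a (bounded-𝔼 ν f-b))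
                      (λ α → 𝔼-scale ν a _ (bounded-slice f-b α)))
                    (𝔼-scale μ a _ (bounded-𝔼 ν f-b))
      }

  -- Uniform averages over bit strings, given a half.

  module Halves (h : Carrier) (h+h≈1 : h + h ≈ 1#) where

    h*x+h*x≈x : ∀ x → h * x + h * x ≈ x
    h*x+h*x≈x x = trans (sym (distribʳ x h h)) (trans (*-congʳ h+h≈1) (*-identityˡ x))

    0≤h : 0# ≤ h
    0≤h with total 0# h
    ... | inj₁ 0≤h = 0≤h
    ... | inj₂ h≤0 = contradiction (antisym 1≤0 0≤1) 1≉0
      where
      1≤0 : 1# ≤ 0#
      1≤0 = begin
        1#       ≈⟨ h+h≈1 ⟨
        h + h    ≤⟨ +-mono-≤ h≤0 h≤0 ⟩
        0# + 0#  ≈⟨ +-identityˡ 0# ⟩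
        0#       ∎

    h*x≈0⇒x≈0 : ∀ {x} → h * x ≈ 0# → x ≈ 0#
    h*x≈0⇒x≈0 {x} h*x≈0 = begin-equality
      x              ≈⟨ h*x+h*x≈x x ⟨
      h * x + h * x  ≈⟨ +-cong h*x≈0 h*x≈0 ⟩
      0# + 0#        ≈⟨ +-identityˡ 0# ⟩
      0#             ∎

    -- This constant, 1/8, will bound the failure probability from below. Doubling cancels one
    -- factor `h` at a time.
    h*[h*h]≉0 : ¬ h * (h * h) ≈ 0#
    h*[h*h]≉0 eq = 1≉0 (h*x≈0⇒x≈0 (trans (*-identityʳ h) (h*x≈0⇒x≈0 (h*x≈0⇒x≈0 eq))))

    -- The expectation over a uniform input, split on the first bit so that halving is the only
    -- division.
    mean : ∀ {n} → (Bits n → Carrier) → Carrier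
    mean {zero}  f = f []
    mean {suc n} f = h * (mean (λ z → f (true ∷ z)) + mean (λ z → f (false ∷ z)))

    mean-mono : ∀ {n} {f g : Bits n → Carrier} → (∀ z → f z ≤ g z) → mean f ≤ mean g
    mean-mono {zero}  f≤g = f≤g []
    mean-mono {suc n} f≤g =
      *-monoʳ-≤ 0≤h (+-mono-≤ (mean-mono (λ z → f≤g (true ∷ z))) (mean-mono (λ z → f≤g (false ∷ z))))

    mean-cong : ∀ {n} {f g : Bits n → Carrier} → (∀ z → f z ≈ g z) → mean f ≈ mean g
    mean-cong f≈g = antisym (mean-mono (≤-reflexive ∘ f≈g)) (mean-mono (≤-reflexive ∘ sym ∘ f≈g))

    mean-const : ∀ n a → mean {n} (λ _ → a) ≈ a
    mean-const zero    a = refl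
    mean-const (suc n) a = begin-equality
      h * (mean {n} (λ _ → a) + mean {n} (λ _ → a))  ≈⟨ *-congˡ (+-cong (mean-const n a) (mean-const n a)) ⟩
      h * (a + a)                                    ≈⟨ distribˡ h a a ⟩
      h * a + h * a                                  ≈⟨ h*x+h*x≈x a ⟩
      a                                              ∎

    mean-+ : ∀ {n} (f g : Bits n → Carrier) → mean (λ z → f z + g z) ≈ mean f + mean g
    mean-+ {zero}  f g = refl
    mean-+ {suc n} f g = trans (*-congˡ (+-cong (mean-+ {n} _ _) (mean-+ {n} _ _)))
      (solve 5 (λ k a b c d → k :* ((a :+ b) :+ (c :+ d)) := k :* (a :+ c) :+ k :* (b :+ d)) refl
        h (mean (f ∘ (true ∷_))) (mean (g ∘ (true ∷_))) (mean (f ∘ (false ∷_))) (mean (g ∘ (false ∷_))))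

    mean-* : ∀ {n} a (f : Bits n → Carrier) → mean (λ z → a * f z) ≈ a * mean f
    mean-* {zero}  a f = refl
    mean-* {suc n} a f = trans (*-congˡ (+-cong (mean-* {n} a _) (mean-* {n} a _)))
      (solve 4 (λ k a b c → k :* ((a :* b) :+ (a :* c)) := a :* (k :* (b :+ c))) refl
        h a (mean (f ∘ (true ∷_))) (mean (f ∘ (false ∷_))))

    mean≤ : ∀ {n a} {f : Bits n → Carrier} → (∀ z → f z ≤ a) → mean f ≤ a
    mean≤ {n} {a} f≤a = ≤-trans (mean-mono f≤a) (≤-reflexive (mean-const n a))

    ≤mean : ∀ {n a} {f : Bits n → Carrier} → (∀ z → a ≤ f z) → a ≤ mean f
    ≤mean {n} {a} a≤f = ≤-trans (≤-reflexive (sym (mean-const n a))) (mean-mono a≤f)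

    bounded-mean : ∀ {Ω n} {f : Bits n → Ω → Carrier} → (∀ z → Bounded 𝔽 (f z)) →
      Bounded 𝔽 (λ ω → mean (λ z → f z ω))
    bounded-mean {n = zero}  f-b = f-b []
    bounded-mean {n = suc n} f-b = bounded-* h
      (bounded-+ (bounded-mean (f-b ∘ (true ∷_))) (bounded-mean (f-b ∘ (false ∷_))))

    -- A mean is a finite linear combination, so it passes through `𝔼` by linearity.
    𝔼-mean : ∀ {Ω n} (μ : Distribution 𝔽 Ω) {f : Bits n → Ω → Carrier} →
      (∀ z → Bounded 𝔽 (f z)) →
      mean (λ z → 𝔼 μ (f z)) ≈ 𝔼 μ (λ ω → mean (λ z → f z ω))
    𝔼-mean {n = zero}  μ f-b = refl
    𝔼-mean {n = suc n} μ {f} f-b = begin-equality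
      h * (mean (λ z → 𝔼 μ (f (true ∷ z))) + mean (λ z → 𝔼 μ (f (false ∷ z))))
        ≈⟨ *-congˡ (+-cong (𝔼-mean μ (f-b ∘ (true ∷_))) (𝔼-mean μ (f-b ∘ (false ∷_)))) ⟩
      h * (𝔼 μ f₁ + 𝔼 μ f₀)
        ≈⟨ *-congˡ (𝔼-add μ f₁ f₀ f₁-b f₀-b) ⟨
      h * 𝔼 μ (λ ω → f₁ ω + f₀ ω)
        ≈⟨ 𝔼-scale μ h _ (bounded-+ f₁-b f₀-b) ⟨
      𝔼 μ (λ ω → h * (f₁ ω + f₀ ω))  ∎
      where
      f₁ = λ ω → mean (λ z → f (true ∷ z) ω)
      f₀ = λ ω → mean (λ z → f (false ∷ z) ω)
      f₁-b = bounded-mean (f-b ∘ (true ∷_))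
      f₀-b = bounded-mean (f-b ∘ (false ∷_))

    private
      _≟_ : ∀ {n} (y z : Bits n) → Dec (y ≡ z)
      _≟_ = ≡-dec _≟ᵇ_

      module _ {n : ℕ} where
        open DecMembership (_≟_ {n}) using (_∈?_) public

    -- The first bit rules out one half of the strings, and induction on the remaining bits handles
    -- the other half.
    mean-≡≤ : ∀ {n} (y : Bits n) → mean (λ z → indicator 𝔽 (z ≟ y)) ≤ h ^ n
    mean-≡≤ []          = indicator≤1 ([] ≟ [])
    mean-≡≤ {suc n} (true ∷ y) = *-monoʳ-≤ 0≤h (begin
      _ + _
        ≤⟨ +-mono-≤
             (≤-trans (mean-mono (λ z → indicator-mono ∷-injectiveʳ ((true ∷ z) ≟ (true ∷ y)) (z ≟ y))) (mean-≡≤ y))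
             (mean≤ (λ z → ≤-reflexive (indicator-no (λ ()) ((false ∷ z) ≟ (true ∷ y))))) ⟩
      h ^ n + 0#  ≈⟨ +-identityʳ _ ⟩
      h ^ n       ∎)
    mean-≡≤ {suc n} (false ∷ y) = *-monoʳ-≤ 0≤h (begin
      _ + _
        ≤⟨ +-mono-≤
             (mean≤ (λ z → ≤-reflexive (indicator-no (λ ()) ((true ∷ z) ≟ (false ∷ y)))))
             (≤-trans (mean-mono (λ z → indicator-mono ∷-injectiveʳ ((false ∷ z) ≟ (false ∷ y)) (z ≟ y))) (mean-≡≤ y)) ⟩
      0# + h ^ n  ≈⟨ +-identityˡ _ ⟩
      h ^ n       ∎)

    -- A union bound over the entries of the list.
    mean-∈≤ : ∀ {n} (ys : List (Bits n)) →
      mean (λ z → indicator 𝔽 (z ∈? ys)) ≤ length ys · (h ^ n)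
    mean-∈≤ {n} []       = mean≤ {n} (λ z → ≤-reflexive (indicator-no (λ ()) (z ∈? [])))
    mean-∈≤ {n} (y ∷ ys) = begin
      mean (λ z → indicator 𝔽 (z ∈? (y ∷ ys)))                          ≤⟨ mean-mono union ⟩
      mean (λ z → indicator 𝔽 (z ≟ y) + indicator 𝔽 (z ∈? ys))          ≈⟨ mean-+ {n} _ _ ⟩
      mean (λ z → indicator 𝔽 (z ≟ y)) + mean (λ z → indicator 𝔽 (z ∈? ys))
        ≤⟨ +-mono-≤ (mean-≡≤ y) (mean-∈≤ ys) ⟩
      h ^ n + length ys · (h ^ n)                                       ∎
      where
      union : ∀ z → indicator 𝔽 (z ∈? (y ∷ ys)) ≤ indicator 𝔽 (z ≟ y) + indicator 𝔽 (z ∈? ys)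
      -- Membership in `y ∷ ys` is decided by comparing with `y` first, so this case split also
      -- evaluates the left-hand side.
      union z with z ≟ y
      ... | yes _ = begin
        1#                             ≈⟨ +-identityʳ 1# ⟨
        1# + 0#                        ≤⟨ +-mono-≤ ≤-refl (0≤indicator (z ∈? ys)) ⟩
        1# + indicator 𝔽 (z ∈? ys)     ∎
      ... | no _ = ≤-reflexive (sym (+-identityˡ _))

    0≤h^n : ∀ n → 0# ≤ h ^ n
    0≤h^n zero    = 0≤1
    0≤h^n (suc n) = *-nonneg 0≤h (0≤h^n n)

    ·-mono-≤ : ∀ {m n x} → 0# ≤ x → m ℕ.≤ n → m · x ≤ n · x
    ·-mono-≤ {n = zero}  0≤x z≤n       = ≤-refl
    ·-mono-≤ {n = suc n} 0≤x z≤n       =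
      ≤-trans (≤-reflexive (sym (+-identityˡ 0#))) (+-mono-≤ 0≤x (·-mono-≤ {0} {n} 0≤x z≤n))
    ·-mono-≤             0≤x (s≤s m≤n) = +-mono-≤ ≤-refl (·-mono-≤ 0≤x m≤n)

    2^m·h^m≈1 : ∀ m → (2 ℕ.^ m) · (h ^ m) ≈ 1#
    2^m·h^m≈1 zero    = +-identityʳ 1#
    2^m·h^m≈1 (suc m) = begin-equality
      (2 ℕ.^ suc m) · (h ^ suc m)                     ≡⟨ ≡.cong (λ k → (2 ℕ.^ m ℕ.+ k) · (h ^ suc m)) (ℕ.+-identityʳ (2 ℕ.^ m)) ⟩
      (2 ℕ.^ m ℕ.+ 2 ℕ.^ m) · (h * h ^ m)             ≈⟨ ×-homo-+ (h * h ^ m) (2 ℕ.^ m) (2 ℕ.^ m) ⟩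
      (2 ℕ.^ m) · (h * h ^ m) + (2 ℕ.^ m) · (h * h ^ m)
        ≈⟨ +-cong (×-comm-* (2 ℕ.^ m) h (h ^ m)) (×-comm-* (2 ℕ.^ m) h (h ^ m)) ⟨
      h * ((2 ℕ.^ m) · (h ^ m)) + h * ((2 ℕ.^ m) · (h ^ m))
        ≈⟨ h*x+h*x≈x _ ⟩
      (2 ℕ.^ m) · (h ^ m)                             ≈⟨ 2^m·h^m≈1 m ⟩
      1#                                              ∎

    -- A list of admissible length covers at most `2 ^ m` of the `2 ^ suc m` strings, and a longer
    -- list never counts as decoding.
    mean-listDecodes≤h : ∀ {m} (Π : Protocol 𝔽 (suc m)) zs →
      mean (λ z → indicator 𝔽 (listDecodes? 𝔽 Π (2 ℕ.^ m) z zs)) ≤ h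
    mean-listDecodes≤h {m} Π zs = bound (length zs ≤? 2 ℕ.^ m)
      where
      decodes? = λ z → listDecodes? 𝔽 Π (2 ℕ.^ m) z zs
      bound : Dec (length zs ℕ.≤ 2 ℕ.^ m) → mean (λ z → indicator 𝔽 (decodes? z)) ≤ h
      bound (no long)   = mean≤ λ z → ≤-trans (≤-reflexive (indicator-no (long ∘ proj₁) (decodes? z))) 0≤h
      bound (yes short) = begin
        mean (λ z → indicator 𝔽 (decodes? z))  ≤⟨ mean-mono (λ z → indicator-mono proj₂ (decodes? z) (z ∈? zs)) ⟩
        mean (λ z → indicator 𝔽 (z ∈? zs))     ≤⟨ mean-∈≤ zs ⟩
        length zs · (h ^ suc m)                ≤⟨ ·-mono-≤ (0≤h^n (suc m)) short ⟩
        (2 ℕ.^ m) · (h ^ suc m)                ≈⟨ ×-comm-* (2 ℕ.^ m) h (h ^ m) ⟨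
        h * ((2 ℕ.^ m) · (h ^ m))              ≈⟨ *-congˡ (2^m·h^m≈1 m) ⟩
        h * 1#                                 ≈⟨ *-identityʳ h ⟩
        h                                      ∎

    -- Averaging the two attacks over inputs and randomness.

    module _ {m : ℕ} (Π : Protocol 𝔽 (suc m)) where
      open Protocol Π
      private
        module A = Party alice
        module B = Party bob

        L : ℕ
        L = 2 ℕ.^ m

        -- An arbitrary fixed input for the isolated Alice; the averages run over the inputs of B
        -- and A₂ only.
        x₀ : Bits (suc m)
        x₀ = replicate (suc m) false

        adv₁ : Adversary Alphabet
        adv₁ = capped rounds symbol (isolateAlice symbol)

        -- One adversary for each simulated randomness `α`; it never consults the randomness of the
        -- real parties.
        adv₂ : A.Ω → Adversary Alphabet
        adv₂ α = capped rounds symbol (impersonateAlice symbol (isolatedSpeech 𝔽 Π x₀ α))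

        -- The first component of an outcome is the randomness of the isolated Alice, who is
        -- real against adv₁ and simulated by adv₂.
        Ω : Set
        Ω = A.Ω × A.Ω × B.Ω

        law : Distribution 𝔽 Ω
        law = A.law ⊗ A.law ⊗ B.law

        succeeds₁ : Bits (suc m) → Ω → Carrier
        succeeds₁ y (α , _ , β) = indicator 𝔽 (success? 𝔽 Π L adv₁ x₀ y α β)

        succeeds₂ : Bits (suc m) → Bits (suc m) → Ω → Carrier
        succeeds₂ y x (α , α′ , β) = indicator 𝔽 (success? 𝔽 Π L (adv₂ α) x y α′ β)

        bounded₁ : ∀ y → Bounded 𝔽 (succeeds₁ y)
        bounded₁ y = bounded-indicator (λ (α , _ , β) → success? 𝔽 Π L adv₁ x₀ y α β)

        bounded₂ : ∀ y x → Bounded 𝔽 (succeeds₂ y x)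
        bounded₂ y x = bounded-indicator (λ (α , α′ , β) → success? 𝔽 Π L (adv₂ α) x y α′ β)

        bounded₁₂ : ∀ y x → Bounded 𝔽 (λ ω → succeeds₁ y ω + succeeds₂ y x ω)
        bounded₁₂ y x = bounded-+ (bounded₁ y) (bounded₂ y x)

      -- With the randomness fixed, an input `y` on the list of A₀ allows at most 2 successes. For
      -- any other `y`, either the first attack defeats the protocol or the second succeeds only if
      -- B's list contains `x`, giving at most `1# + h` on average. As at most a fraction `h` of the
      -- inputs `y` are listed, the total is at most 7/4.
      mean-successes≤ : ∀ ω →
        mean (λ y → mean (λ x → succeeds₁ y ω + succeeds₂ y x ω)) ≤ (1# + h) + h * h
      mean-successes≤ ω@(α , α′ , β) = begin
        mean (λ y → mean (λ x → succeeds₁ y ω + succeeds₂ y x ω))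
          ≤⟨ mean-mono perInput ⟩
        mean (λ y → (1# + h) + h * indicator 𝔽 (aliceDecodes? y))
          ≈⟨ mean-+ {suc m} (λ _ → 1# + h) (λ y → h * indicator 𝔽 (aliceDecodes? y)) ⟩
        mean {suc m} (λ _ → 1# + h) + mean (λ y → h * indicator 𝔽 (aliceDecodes? y))
          ≈⟨ +-cong (mean-const (suc m) _) (mean-* {suc m} h (λ y → indicator 𝔽 (aliceDecodes? y))) ⟩
        (1# + h) + h * mean (λ y → indicator 𝔽 (aliceDecodes? y))
          ≤⟨ +-mono-≤ ≤-refl (*-monoʳ-≤ 0≤h (mean-listDecodes≤h Π aliceList)) ⟩
        (1# + h) + h * h  ∎
        where
        aliceList : List (Bits (suc m))
        aliceList = A.output x₀ α (isolatedView 𝔽 Π x₀ α rounds)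

        bobList : Bits (suc m) → List (Bits (suc m))
        bobList y = B.output y β (deceivedView 𝔽 Π x₀ α y β rounds)

        aliceDecodes? = λ y → listDecodes? 𝔽 Π L y aliceList
        bobDecodes? = λ y x → listDecodes? 𝔽 Π L x (bobList y)

        ifNotDecoded : ∀ y → ¬ ListDecodes 𝔽 Π L y aliceList → ∀ x →
          succeeds₁ y ω + succeeds₂ y x ω ≤ 1# + indicator 𝔽 (bobDecodes? y x)
        ifNotDecoded y ¬decoded x with isolation-or-deception 𝔽 Π x₀ α y β L x α′
        ... | inj₁ isolated = begin
          succeeds₁ y ω + succeeds₂ y x ω
            ≤⟨ +-mono-≤ (≤-reflexive (indicator-no (¬decoded ∘ isolated) (success? 𝔽 Π L adv₁ x₀ y α β)))
                        (indicator≤1 (success? 𝔽 Π L (adv₂ α) x y α′ β)) ⟩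
          0# + 1#                                ≈⟨ +-comm 0# 1# ⟩
          1# + 0#                                ≤⟨ +-mono-≤ ≤-refl (0≤indicator (bobDecodes? y x)) ⟩
          1# + indicator 𝔽 (bobDecodes? y x)     ∎
        ... | inj₂ deceived = +-mono-≤
          (indicator≤1 (success? 𝔽 Π L adv₁ x₀ y α β))
          (indicator-mono deceived (success? 𝔽 Π L (adv₂ α) x y α′ β) (bobDecodes? y x))

        -- The decision is an argument so that matching on it evaluates its indicator in the bound.
        byDecoded : ∀ y → (decoded? : Dec (ListDecodes 𝔽 Π L y aliceList)) →
          mean (λ x → succeeds₁ y ω + succeeds₂ y x ω) ≤ (1# + h) + h * indicator 𝔽 decoded?
        byDecoded y (yes _) = begin
          mean (λ x → succeeds₁ y ω + succeeds₂ y x ω)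
            ≤⟨ mean≤ (λ x → +-mono-≤ (indicator≤1 (success? 𝔽 Π L adv₁ x₀ y α β))
                                     (indicator≤1 (success? 𝔽 Π L (adv₂ α) x y α′ β))) ⟩
          1# + 1#              ≈⟨ +-congˡ h+h≈1 ⟨
          1# + (h + h)         ≈⟨ +-assoc 1# h h ⟨
          (1# + h) + h         ≈⟨ +-congˡ (*-identityʳ h) ⟨
          (1# + h) + h * 1#    ∎
        byDecoded y (no ¬decoded) = begin
          mean (λ x → succeeds₁ y ω + succeeds₂ y x ω)
            ≤⟨ mean-mono (ifNotDecoded y ¬decoded) ⟩
          mean (λ x → 1# + indicator 𝔽 (bobDecodes? y x))
            ≈⟨ mean-+ {suc m} (λ _ → 1#) (λ x → indicator 𝔽 (bobDecodes? y x)) ⟩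
          mean {suc m} (λ _ → 1#) + mean (λ x → indicator 𝔽 (bobDecodes? y x))
            ≤⟨ +-mono-≤ (≤-reflexive (mean-const (suc m) 1#)) (mean-listDecodes≤h Π (bobList y)) ⟩
          1# + h               ≈⟨ +-identityʳ _ ⟨
          (1# + h) + 0#        ≈⟨ +-congˡ (zeroʳ h) ⟨
          (1# + h) + h * 0#    ∎

        perInput : ∀ y → mean (λ x → succeeds₁ y ω + succeeds₂ y x ω) ≤
                         (1# + h) + h * indicator 𝔽 (aliceDecodes? y)
        perInput y = byDecoded y (aliceDecodes? y)

      module _ {p : Carrier} (simulates : RobustlySimulates 𝔽 Π L ½ p) where

        -- The second Alice's randomness does not enter `succeeds₁`, so integrating over it changes
        -- nothing.
        𝔼-succeeds₁ : ∀ y → 1# - p ≤ 𝔼 law (succeeds₁ y)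
        𝔼-succeeds₁ y = begin
          1# - p
            ≤⟨ simulates x₀ y adv₁ (capped-hasErrorRate 𝔽 Π (isolateAlice symbol)) ⟩
          ℙ 𝔽 A.law B.law (success? 𝔽 Π L adv₁ x₀ y)
            ≈⟨ 𝔼-cong A.law _ _ (bounded-𝔼 (A.law ⊗ B.law) (bounded₁ y))
                 (bounded-𝔼 B.law (bounded-indicator (λ (α , β) → success? 𝔽 Π L adv₁ x₀ y α β)))
                 (λ α → 𝔼-const A.law _) ⟨
          𝔼 law (succeeds₁ y)  ∎

        -- The guarantee holds against `adv₂ α` for each `α` separately, hence also on average.
        𝔼-succeeds₂ : ∀ y x → 1# - p ≤ 𝔼 law (succeeds₂ y x)
        𝔼-succeeds₂ y x = ≤𝔼 A.law _ (bounded-𝔼 (A.law ⊗ B.law) (bounded₂ y x))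
          (λ α → simulates x y (adv₂ α) (capped-hasErrorRate 𝔽 Π _))

        -- The lower bound holds for each pair of inputs and the upper bound for each outcome;
        -- exchanging `mean` and `𝔼` makes them meet.
        successes≤ : (1# - p) + (1# - p) ≤ (1# + h) + h * h
        successes≤ = begin
          (1# - p) + (1# - p)
            ≤⟨ ≤mean (λ y → ≤mean (λ x → begin
                 (1# - p) + (1# - p)
                   ≤⟨ +-mono-≤ (𝔼-succeeds₁ y) (𝔼-succeeds₂ y x) ⟩
                 𝔼 law (succeeds₁ y) + 𝔼 law (succeeds₂ y x)
                   ≈⟨ 𝔼-add law _ _ (bounded₁ y) (bounded₂ y x) ⟨
                 𝔼 law (λ ω → succeeds₁ y ω + succeeds₂ y x ω)  ∎)) ⟩
          mean (λ y → mean (λ x → 𝔼 law (λ ω → succeeds₁ y ω + succeeds₂ y x ω)))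
            ≈⟨ mean-cong (λ y → 𝔼-mean law (bounded₁₂ y)) ⟩
          mean (λ y → 𝔼 law (λ ω → mean (λ x → succeeds₁ y ω + succeeds₂ y x ω)))
            ≈⟨ 𝔼-mean law (λ y → bounded-mean (bounded₁₂ y)) ⟩
          𝔼 law (λ ω → mean (λ y → mean (λ x → succeeds₁ y ω + succeeds₂ y x ω)))
            ≤⟨ 𝔼≤ law _ (bounded-mean (λ y → bounded-mean (bounded₁₂ y))) mean-successes≤ ⟩
          (1# + h) + h * h  ∎

        failure-bound : h * (h * h) ≤ p
        failure-bound = begin
          h * (h * h)       ≤⟨ *-monoʳ-≤ 0≤h h*h≤p+p ⟩
          h * (p + p)       ≈⟨ distribˡ h p p ⟩
          h * p + h * p     ≈⟨ h*x+h*x≈x p ⟩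
          p                 ∎
          where
          cancel : ∀ q → (1# - q) + q ≈ 1#
          cancel q = trans (+-assoc 1# (- q) q) (trans (+-congˡ (-‿inverseˡ q)) (+-identityʳ 1#))

          -- The gap between 2 and 7/4 is `h * h`; it must be absorbed by the two failure
          -- probabilities.
          slack : 1# + 1# ≈ ((1# + h) + h * h) + h * h
          slack = begin-equality
            1# + 1#                        ≈⟨ +-congˡ h+h≈1 ⟨
            1# + (h + h)                   ≈⟨ +-congˡ (+-congˡ (h*x+h*x≈x h)) ⟨
            1# + (h + (h * h + h * h))     ≈⟨ solve 3 (λ a b c → a :+ (b :+ (c :+ c)) := ((a :+ b) :+ c) :+ c) refl 1# h (h * h) ⟩
            ((1# + h) + h * h) + h * h     ∎

          total≤ : ((1# + h) + h * h) + h * h ≤ ((1# + h) + h * h) + (p + p)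
          total≤ = begin
            ((1# + h) + h * h) + h * h             ≈⟨ slack ⟨
            1# + 1#                                ≈⟨ +-cong (cancel p) (cancel p) ⟨
            ((1# - p) + p) + ((1# - p) + p)        ≈⟨ solve 2 (λ a b → (a :+ b) :+ (a :+ b) := (a :+ a) :+ (b :+ b)) refl (1# - p) p ⟩
            ((1# - p) + (1# - p)) + (p + p)        ≤⟨ +-monoˡ-≤ (p + p) successes≤ ⟩
            ((1# + h) + h * h) + (p + p)           ∎

          h*h≤p+p : h * h ≤ p + p
          h*h≤p+p = +-cancelˡ-≤ ((1# + h) + h * h) total≤

  -- From the constant lower bound to the impossibility.

  -- Convergence is applied with tolerance `ε` itself. It asks for `ε` apart from `0#`, which
  -- inequality provides only up to double negation; that is enough for a contradiction.
  ≥⇒¬TendsToZero : ∀ {ε} {p : ℕ → Carrier} → ¬ ε ≈ 0# → 0# ≤ ε →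
    (∀ k → ε ≤ p k) → ¬ TendsToZero 𝔽 p
  ≥⇒¬TendsToZero {ε} {p} ε≉0 0≤ε ε≤p p→0 = ≉⇒¬¬# (ε≉0 ∘ sym) λ 0#ε →
    let K , close = p→0 ε (0≤ε , 0#ε)
        pK≤ε , pK#ε = proj₂ (close K ℕ.≤-refl)
    in #-irrefl (antisym pK≤ε (ε≤p K)) pK#ε

open import Data.Nat using (_≤_; _∸_; _^_)

lemmaC2 : ∀ {c ℓ₁ ℓ₂ ℓ₃} (𝔽 : OrderedField c ℓ₁ ℓ₂ ℓ₃)
    (n : ℕ → ℕ) → (∀ k → 1 ≤ n k) →
    (Π : ∀ k → Protocol 𝔽 (n k))
    (p : ℕ → OrderedField.Carrier 𝔽) →
    (∀ k → RobustlySimulates 𝔽 (Π k) (2 ^ (n k ∸ 1)) ½ (p k)) →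
    ¬ TendsToZero 𝔽 p
lemmaC2 𝔽 n 1≤n Π p simulates p→0 = ¬¬half 𝔽 λ h h+h≈1 →
  let open Halves 𝔽 h h+h≈1
      open OrderedField 𝔽 using (_*_; *-nonneg) renaming (_≤_ to _≤ᶠ_)
      bound : ∀ {n} → 1 ≤ n → (Π : Protocol 𝔽 n) → ∀ {p} →
              RobustlySimulates 𝔽 Π (2 ^ (n ∸ 1)) ½ p → (h * (h * h)) ≤ᶠ p
      -- Matching on `s≤s` exposes the length as a successor, so that `n ∸ 1` reduces to the
      -- exponent used in `failure-bound`.
      bound = λ { (s≤s _) Π → failure-bound Π }
  in ≥⇒¬TendsToZero 𝔽 h*[h*h]≉0 (*-nonneg 0≤h (*-nonneg 0≤h 0≤h))
       (λ k → bound (1≤n k) (Π k) (simulates k)) p→0
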